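{- Let $n, r, d$ be positive integers with $n\geqslant r+1$ and $d\geqslant 2$, and let $\delta=(d-2)/(d-1)$. Then $$\frac{1}{r}\binom{d+r}{d+1}\leqslant m\!\left(K_n^d, r\right)\leqslant\frac{(r+2d-1)^d-\delta^2(r-2)^d}{2\,d!}.$$
   Context: All graphs are finite, simple and undirected. For an integer $r\geqslant 0$ and a graph $G$, the $r$-neighbor bootstrap percolation process on $G$ starts with a set $A_0\subseteq V(G)$ of initially active vertices, and for $i\geqslant 1$, $A_i=A_{i-1}\cup\{v\in V(G): |N(v)\cap A_{i-1}|\geqslant r\}$, where $N(v)$ is the set of neighbors of $v$. The set $A_0$ is a percolating set if $\bigcup_{i\geqslant 0}A_i=V(G)$. $m(G,r)$ denotes the minimum size of a percolating set of $G$ in the $r$-neighbor bootstrap percolation process. $K_n^d$ (the Hamming graph) is the Cartesian product of $d$ copies of the complete graph $K_n$; equivalently its vertex set is $\{0,1,\ldots,n-1\}^d$ and two vertices are adjacent iff they differ in exactly one coordinate. -}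

module Defs where

open import Data.Nat using (ℕ; zero; suc; _+_; _≤ᵇ_)
open import Data.Bool using (Bool; true; false; _∧_; _∨_; if_then_else_)
open import Data.List using (List; []; _∷_; map; concatMap)
open import Data.Fin using (Fin)
open import Data.Fin.Properties using (_≟_)
open import Data.Vec using (Vec; []; _∷_)
open import Data.Product using (∃-syntax; _×_)
open import Relation.Nullary using (does)
open import Relation.Binary.PropositionalEquality using (_≡_)
import Data.Fin as F

-- Generic r-neighbour bootstrap percolation on a finite graph given by
-- a list `verts` enumerating every vertex exactly once and a Boolean
-- adjacency relation `adj`. Vertex subsets are Boolean predicates.

count : {V : Set} → (V → Bool) → List V → ℕ
count p []       = 0
count p (x ∷ xs) = (if p x then 1 else 0) + count p xs

module Bootstrap {V : Set} (verts : List V) (adj : V → V → Bool) where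

  size : (V → Bool) → ℕ
  size A = count A verts

  step : ℕ → (V → Bool) → (V → Bool)
  step r A v = A v ∨ (r ≤ᵇ count (λ u → adj v u ∧ A u) verts)

  active : ℕ → (V → Bool) → ℕ → (V → Bool)
  active r A₀ zero    = A₀
  active r A₀ (suc i) = step r (active r A₀ i)

  Percolating : ℕ → (V → Bool) → Set
  Percolating r A₀ = ∀ v → ∃[ i ] (active r A₀ i v ≡ true)

  IsMinPercolatingSize : ℕ → ℕ → Set
  IsMinPercolatingSize r k =
    (∃[ A₀ ] (Percolating r A₀ × size A₀ ≡ k)) ×
    (∀ A₀ → Percolating r A₀ → k Data.Nat.≤ size A₀)

HVertex : ℕ → ℕ → Set
HVertex n d = Vec (Fin n) d

allVerts : (n d : ℕ) → List (HVertex n d)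
allVerts n zero    = [] ∷ []
allVerts n (suc d) = concatMap (λ x → map (x ∷_) (allVerts n d)) (allFin n)
  where open import Data.List using (allFin)

hamming : {n d : ℕ} → HVertex n d → HVertex n d → ℕ
hamming []       []       = 0
hamming (x ∷ xs) (y ∷ ys) = (if does (x ≟ y) then 0 else 1) + hamming xs ys

hammingAdj : {n d : ℕ} → HVertex n d → HVertex n d → Bool
hammingAdj u v = Data.Nat._≡ᵇ_ (hamming u v) 1

IsMHamming : (n d r k : ℕ) → Set
IsMHamming n d r k =
  Bootstrap.IsMinPercolatingSize (allVerts n d) hammingAdj r k

{-# OPTIONS --safe #-}

-- Lower bound. Consider the symmetric polynomials Q in d + 1 variables of degree less than r in each; their dimension is
-- C(d + r, d + 1). Give the value y of coordinate i its own integer label, so that by symmetry the edge from v to the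
-- vertex u obtained by changing v_i to y has the well-defined weight Q(v, y) = Q(u, v_i). If Q(v, ·) = 0 for every v in a
-- percolating set A, then Q(w, ·) = 0 for each vertex w in order of activation, since Q(w, ·) has degree less than r and
-- vanishes at the r labels of the edges to active neighbours; so Q vanishes on the whole grid, and Q = 0. As Q(v, ·) = 0
-- is r linear equations on Q, this forces C(d + r, d + 1) ≤ r |A|.
--
-- Upper bound. The vertices whose coordinate sum is at most r − 1 and congruent to r − 1 modulo d percolate, in order of
-- increasing sum: an inactive vertex of sum s < r has s active neighbours below it, and at least (r − s)/d seeds above it
-- in each of d directions. There are at most (r + 2d − 2)^d / (d · d!) of them, which is smaller than the stated bound
-- because 2/d ≤ 1 − δ².
module Submission where

open import Defs
open import Data.Nat using (ℕ; _≤_; _*_; _+_; _∸_; _!)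
open import Data.Nat.Combinatorics using (_C_)
open import Data.Integer using (ℤ; +_; _-_; _^_) renaming (_*_ to _*ℤ_; _≤_ to _≤ℤ_)
open import Data.Product using (∃-syntax; _×_)

open import Data.Bool using (Bool; true; false; _∧_; _∨_; if_then_else_)
import Data.Bool.Properties as Bool
open import Data.Empty using (⊥-elim)
open import Data.Fin using (Fin; zero; suc; toℕ)
import Data.Fin.Properties as Fin
open import Data.Integer using (0ℤ; 1ℤ; -_; ∣_∣; -[1+_]; -≤+) renaming (_+_ to _+ℤ_)
import Data.Integer as ℤ using (+≤+)
import Data.Integer.Properties as ℤ
open import Data.Integer.Tactic.RingSolver using (solve-∀)
open import Data.List using (List; []; _∷_; _++_; map; length; tabulate; concatMap; filter)
open import Data.List.Membership.Propositional using (_∈_; lose)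
open import Data.List.Membership.Propositional.Properties
  using (∈-concatMap⁺; ∈-allFin; ∈-map⁺; ∈-map⁻; ∈-filter⁺)
open import Data.List.Properties using (length-map; length-++; length-tabulate)
open import Data.List.Relation.Unary.All as All using (All; []; _∷_; all?)
import Data.List.Relation.Unary.All.Properties as All
open import Data.List.Relation.Unary.AllPairs using ([]; _∷_)
open import Data.List.Relation.Unary.Any using (Any; here; there)
open import Data.List.Relation.Unary.Unique.Propositional using (Unique)
import Data.List.Relation.Unary.Unique.Propositional.Properties as Unique
open import Data.Nat using (zero; suc; _<_; z≤n; s≤s; _≤ᵇ_; _≡ᵇ_; NonZero)
import Data.Nat as ℕ using (_^_; _≤?_; _<?_; >-nonZero⁻¹)
open import Data.Nat.Combinatorics using (nCk+nC[k+1]≡[n+1]C[k+1]; nCn≡1)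
open import Data.Nat.Divisibility using (_∣?_; divides; divides-refl)
open import Data.Nat.Properties
open import Data.Nat.Tactic.RingSolver renaming (solve-∀ to solve-∀ⁿ)
open import Data.Product using (_,_; proj₁; proj₂)
open import Data.Sum using (_⊎_; inj₁; inj₂; [_,_]′)
open import Data.Vec using (Vec; []; _∷_; updateAt; replicate)
import Data.Vec as Vec using (map)
import Data.Vec.Properties as Vec
open import Function using (_∘_; id; Equivalence)
open import Relation.Binary.Definitions using (DecidableEquality)
open import Relation.Binary.PropositionalEquality
open import Relation.Nullary using (does; yes; no; ¬_; Dec)
open import Relation.Nullary.Decidable using (dec-true; map′)

open import Algebra.Properties.CommutativeMonoid.Sum +-0-commutativeMonoid
  using (sum; sum-cong-≗; sum-replicate-zero)
open import Data.List.Extrema ≤-totalOrder using (argmin; argmin-all; f[argmin]≤f[xs])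

-- Counting neighbours in the Hamming graph

bit : Bool → ℕ
bit b = if b then 1 else 0

module _ {A : Set} where

  count-cong : {p q : A → Bool} → (∀ x → p x ≡ q x) → ∀ xs → count p xs ≡ count q xs
  count-cong p≗q []       = refl
  count-cong p≗q (x ∷ xs) = cong₂ _+_ (cong bit (p≗q x)) (count-cong p≗q xs)

  count-false : (xs : List A) → count (λ _ → false) xs ≡ 0
  count-false []       = refl
  count-false (x ∷ xs) = count-false xs

  count-++ : (p : A → Bool) (xs ys : List A) → count p (xs ++ ys) ≡ count p xs + count p ys
  count-++ p []       ys = refl
  count-++ p (x ∷ xs) ys = trans (cong₂ _+_ refl (count-++ p xs ys)) (sym (+-assoc (bit (p x)) _ _))

  count-map : {B : Set} (p : A → Bool) (f : B → A) (xs : List B) → count p (map f xs) ≡ count (p ∘ f) xs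
  count-map p f []       = refl
  count-map p f (x ∷ xs) = cong₂ _+_ refl (count-map p f xs)

  count-concatMap-tabulate : {B : Set} {n : ℕ} (p : A → Bool) (g : B → List A) (h : Fin n → B) →
    count p (concatMap g (tabulate h)) ≡ sum (λ y → count p (g (h y)))
  count-concatMap-tabulate {n = zero}  p g h = refl
  count-concatMap-tabulate {n = suc n} p g h =
    trans (count-++ p (g (h zero)) _) (cong₂ _+_ refl (count-concatMap-tabulate p g (h ∘ suc)))

count-allVerts : ∀ n d (p : HVertex n (suc d) → Bool) →
  count p (allVerts n (suc d)) ≡ sum (λ y → count (p ∘ (y ∷_)) (allVerts n d))
count-allVerts n d p =
  trans (count-concatMap-tabulate p (λ x → map (x ∷_) (allVerts n d)) id)
        (sum-cong-≗ (λ y → count-map p (y ∷_) (allVerts n d)))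

sum-split : ∀ {n} (x : Fin n) (f : Fin n → ℕ) → sum f ≡ f x + sum (λ y → if does (x Fin.≟ y) then 0 else f y)
sum-split zero    f = refl
sum-split (suc x) f = begin
  f zero + sum (f ∘ suc)         ≡⟨ cong₂ _+_ refl (sum-split x (f ∘ suc)) ⟩
  f zero + (f (suc x) + rest)    ≡⟨ +-assoc (f zero) _ _ ⟨
  f zero + f (suc x) + rest      ≡⟨ cong (_+ rest) (+-comm (f zero) _) ⟩
  f (suc x) + f zero + rest      ≡⟨ +-assoc (f (suc x)) _ _ ⟩
  f (suc x) + (f zero + rest)    ∎
  where
  open ≡-Reasoning
  rest = sum (λ y → if does (x Fin.≟ y) then 0 else f (suc y))

does-≟-refl : ∀ {n} (x : Fin n) → does (x Fin.≟ x) ≡ true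
does-≟-refl x = dec-true (x Fin.≟ x) refl

count-hamming≡0 : ∀ {n d} (v : HVertex n d) (p : HVertex n d → Bool) →
  count (λ u → (hamming v u ≡ᵇ 0) ∧ p u) (allVerts n d) ≡ bit (p v)
count-hamming≡0             []       p = +-identityʳ (bit (p []))
count-hamming≡0 {n} {suc d} (x ∷ xs) p = begin
  count (λ u → (hamming (x ∷ xs) u ≡ᵇ 0) ∧ p u) (allVerts n (suc d))
    ≡⟨ count-allVerts n d _ ⟩
  sum f
    ≡⟨ sum-split x f ⟩
  f x + sum (λ y → if does (x Fin.≟ y) then 0 else f y)
    ≡⟨ cong₂ _+_ same (trans (sum-cong-≗ (λ y → other (does (x Fin.≟ y)) (p ∘ (y ∷_))))
                             (sum-replicate-zero n)) ⟩
  bit (p (x ∷ xs)) + 0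
    ≡⟨ +-identityʳ _ ⟩
  bit (p (x ∷ xs)) ∎
  where
  open ≡-Reasoning
  g : Bool → (HVertex n d → Bool) → ℕ
  g b q = count (λ u → ((if b then 0 else 1) + hamming xs u ≡ᵇ 0) ∧ q u) (allVerts n d)
  f : Fin n → ℕ
  f y = g (does (x Fin.≟ y)) (p ∘ (y ∷_))
  same : f x ≡ bit (p (x ∷ xs))
  same rewrite does-≟-refl x = count-hamming≡0 xs (p ∘ (x ∷_))
  other : ∀ b q → (if b then 0 else g b q) ≡ 0
  other true  q = refl
  other false q = count-false (allVerts n d)

lineNeighbours : ∀ {n} → Fin n → (Fin n → Bool) → Fin n → Bool
lineNeighbours x p y = if does (x Fin.≟ y) then false else p y

-- The neighbour count arranged by coordinate direction. It recurses on the vertex just as the edge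
-- labels and the coordinate sum do, so both bounds can be proved one line at a time.
neighbours : ∀ {n d} → (HVertex n d → Bool) → HVertex n d → ℕ
neighbours p []       = 0
neighbours p (x ∷ xs) = sum (bit ∘ lineNeighbours x (λ y → p (y ∷ xs))) + neighbours (p ∘ (x ∷_)) xs

-- A neighbour either keeps the first coordinate and is adjacent in the others, or changes the first
-- coordinate and agrees in the others. `sum-split` separates the two cases; the second contributes
-- at most one vertex per new value.
count-adj : ∀ {n d} (v : HVertex n d) (p : HVertex n d → Bool) →
  count (λ u → hammingAdj v u ∧ p u) (allVerts n d) ≡ neighbours p v
count-adj             []       p = refl
count-adj {n} {suc d} (x ∷ xs) p = begin
  count (λ u → hammingAdj (x ∷ xs) u ∧ p u) (allVerts n (suc d))
    ≡⟨ count-allVerts n d _ ⟩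
  sum f
    ≡⟨ sum-split x f ⟩
  f x + sum (λ y → if does (x Fin.≟ y) then 0 else f y)
    ≡⟨ cong₂ _+_ same (sum-cong-≗ (λ y → other (does (x Fin.≟ y)) (p ∘ (y ∷_)))) ⟩
  neighbours (p ∘ (x ∷_)) xs + sum (bit ∘ lineNeighbours x (λ y → p (y ∷ xs)))
    ≡⟨ +-comm (neighbours (p ∘ (x ∷_)) xs) _ ⟩
  neighbours p (x ∷ xs) ∎
  where
  open ≡-Reasoning
  g : Bool → (HVertex n d → Bool) → ℕ
  g b q = count (λ u → ((if b then 0 else 1) + hamming xs u ≡ᵇ 1) ∧ q u) (allVerts n d)
  f : Fin n → ℕ
  f y = g (does (x Fin.≟ y)) (p ∘ (y ∷_))
  same : f x ≡ neighbours (p ∘ (x ∷_)) xs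
  same rewrite does-≟-refl x = count-adj xs (p ∘ (x ∷_))
  other : ∀ b q → (if b then 0 else g b q) ≡ bit (if b then false else q xs)
  other true  q = refl
  other false q = count-hamming≡0 xs q

-- Integer polynomials and homogeneous linear systems

-- Horner evaluation, constant coefficient first; `k` coefficients mean degree less than `k`.
eval : ∀ {k} → (Fin k → ℤ) → ℤ → ℤ
eval {zero}  c t = 0ℤ
eval {suc k} c t = c zero +ℤ t *ℤ eval (c ∘ suc) t

eval-cong : ∀ {k} {c e : Fin k → ℤ} → (∀ a → c a ≡ e a) → ∀ t → eval c t ≡ eval e t
eval-cong {zero}  c≗e t = refl
eval-cong {suc k} c≗e t = cong₂ (λ u w → u +ℤ t *ℤ w) (c≗e zero) (eval-cong (c≗e ∘ suc) t)

eval-linear : ∀ {k} (u w : ℤ) (c e : Fin k → ℤ) t →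
  eval (λ a → u *ℤ c a +ℤ w *ℤ e a) t ≡ u *ℤ eval c t +ℤ w *ℤ eval e t
eval-linear {zero}  u w c e t = lemma u w
  where
  lemma : ∀ u w → 0ℤ ≡ u *ℤ 0ℤ +ℤ w *ℤ 0ℤ
  lemma = solve-∀
eval-linear {suc k} u w c e t
  rewrite eval-linear u w (c ∘ suc) (e ∘ suc) t = lemma u w (c zero) (e zero) t (eval (c ∘ suc) t) (eval (e ∘ suc) t)
  where
  lemma : ∀ u w c₀ e₀ t P Q → (u *ℤ c₀ +ℤ w *ℤ e₀) +ℤ t *ℤ (u *ℤ P +ℤ w *ℤ Q)
                            ≡ u *ℤ (c₀ +ℤ t *ℤ P) +ℤ w *ℤ (e₀ +ℤ t *ℤ Q)
  lemma = solve-∀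

eval-0 : ∀ {k} (t : ℤ) → eval {k} (λ _ → 0ℤ) t ≡ 0ℤ
eval-0 {zero}  t = refl
eval-0 {suc k} t = trans (cong (λ w → 0ℤ +ℤ t *ℤ w) (eval-0 {k} t)) (trans (ℤ.+-identityˡ _) (ℤ.*-zeroʳ t))

eval-swap : ∀ {k l} (F : Fin k → Fin l → ℤ) x y →
  eval (λ a → eval (F a) y) x ≡ eval (λ b → eval (λ a → F a b) x) y
eval-swap {zero} {l} F x y = sym (eval-0 {l} y)
eval-swap {suc k} F x y = begin
  eval (F zero) y +ℤ x *ℤ eval (λ a → eval (F (suc a)) y) x
    ≡⟨ cong₂ _+ℤ_ (sym (ℤ.*-identityˡ (eval (F zero) y))) (cong (x *ℤ_) (eval-swap (F ∘ suc) x y)) ⟩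
  1ℤ *ℤ eval (F zero) y +ℤ x *ℤ eval (λ b → eval (λ a → F (suc a) b) x) y
    ≡⟨ eval-linear 1ℤ x (F zero) (λ b → eval (λ a → F (suc a) b) x) y ⟨
  eval (λ b → 1ℤ *ℤ F zero b +ℤ x *ℤ eval (λ a → F (suc a) b) x) y
    ≡⟨ eval-cong (λ b → cong (_+ℤ x *ℤ eval (λ a → F (suc a) b) x) (ℤ.*-identityˡ (F zero b))) y ⟩
  eval (λ b → F zero b +ℤ x *ℤ eval (λ a → F (suc a) b) x) y ∎
  where open ≡-Reasoning

-- Division by linear factors and integer roots

quotient : ∀ {k} → (Fin (suc k) → ℤ) → ℤ → Fin k → ℤ
quotient c ρ zero    = eval (c ∘ suc) ρ
quotient c ρ (suc a) = quotient (c ∘ suc) ρ a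

-- Synthetic division and the remainder theorem: each coefficient of the quotient by t - ρ is the
-- Horner value at ρ of the higher coefficients of `c`.
eval-quotient : ∀ {k} (c : Fin (suc k) → ℤ) ρ t →
  eval c t ≡ eval c ρ +ℤ (t - ρ) *ℤ eval (quotient c ρ) t
eval-quotient {zero}  c ρ t = lemma (c zero) ρ t
  where
  lemma : ∀ c ρ t → c +ℤ t *ℤ 0ℤ ≡ (c +ℤ ρ *ℤ 0ℤ) +ℤ (t - ρ) *ℤ 0ℤ
  lemma = solve-∀
eval-quotient {suc k} c ρ t =
  trans (cong (λ P → c zero +ℤ t *ℤ P) (eval-quotient (c ∘ suc) ρ t))
        (lemma (c zero) ρ t (eval (c ∘ suc) ρ) (eval (quotient (c ∘ suc) ρ) t))
  where
  lemma : ∀ c ρ t R Q → c +ℤ t *ℤ (R +ℤ (t - ρ) *ℤ Q) ≡ (c +ℤ ρ *ℤ R) +ℤ (t - ρ) *ℤ (R +ℤ t *ℤ Q)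
  lemma = solve-∀

quotient-zero : ∀ {k} (c : Fin (suc k) → ℤ) ρ → eval c ρ ≡ 0ℤ → (∀ a → quotient c ρ a ≡ 0ℤ) →
  ∀ a → c a ≡ 0ℤ
quotient-zero {k} c ρ root q≡0 zero = trans (lemma (c zero) ρ) (trans (cong (λ P → c zero +ℤ ρ *ℤ P) (tail≡0 k q≡0)) root)
  where
  lemma : ∀ c₀ ρ → c₀ ≡ c₀ +ℤ ρ *ℤ 0ℤ
  lemma = solve-∀
  tail≡0 : ∀ k {c : Fin (suc k) → ℤ} → (∀ a → quotient c ρ a ≡ 0ℤ) → 0ℤ ≡ eval (c ∘ suc) ρ
  tail≡0 zero    q≡0 = refl
  tail≡0 (suc k) q≡0 = sym (q≡0 zero)
quotient-zero {suc k} c ρ root q≡0 (suc a) = quotient-zero (c ∘ suc) ρ (q≡0 zero) (q≡0 ∘ suc) a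

-- Strict increase stands for distinctness: a root taken from the head is smaller than every later
-- one.
data Ascending : ℕ → List ℕ → Set where
  []  : ∀ {b} → Ascending b []
  _∷_ : ∀ {b t ts} → b ≤ t → Ascending (suc t) ts → Ascending b (t ∷ ts)

Ascending-≤ : ∀ {b c ts} → b ≤ c → Ascending c ts → Ascending b ts
Ascending-≤ b≤c []           = []
Ascending-≤ b≤c (c≤t ∷ asc)  = ≤-trans b≤c c≤t ∷ asc

Root : ∀ {k} → (Fin k → ℤ) → ℕ → Set
Root c t = eval c (+ t) ≡ 0ℤ

-- At a later root t the division identity leaves (t - ρ) q(t) = 0. Since t > ρ and the integers
-- have no zero divisors, q(t) = 0.
roots-of-quotient : ∀ {k} (c : Fin (suc k) → ℤ) ρ {b ts} → Root c ρ → ρ < b → Ascending b ts →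
  All (Root c) ts → All (Root (quotient c (+ ρ))) ts
roots-of-quotient c ρ root ρ<b []          []              = []
roots-of-quotient c ρ root ρ<b (b≤t ∷ asc) (_∷_ {t} root′ roots) =
  quotient-root ∷ roots-of-quotient c ρ root (m<n⇒m<1+n (<-≤-trans ρ<b b≤t)) asc roots
  where
  product≡0 : (+ t - + ρ) *ℤ eval (quotient c (+ ρ)) (+ t) ≡ 0ℤ
  product≡0 = begin
    product                    ≡⟨ ℤ.+-identityˡ product ⟨
    0ℤ +ℤ product              ≡⟨ cong (_+ℤ product) root ⟨
    eval c (+ ρ) +ℤ product    ≡⟨ eval-quotient c (+ ρ) (+ t) ⟨
    eval c (+ t)               ≡⟨ root′ ⟩
    0ℤ                         ∎
    where
    open ≡-Reasoning
    product = (+ t - + ρ) *ℤ eval (quotient c (+ ρ)) (+ t)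
  quotient-root : Root (quotient c (+ ρ)) t
  quotient-root with ℤ.i*j≡0⇒i≡0∨j≡0 (+ t - + ρ) product≡0
  ... | inj₂ eq = eq
  ... | inj₁ eq = ⊥-elim (<⇒≢ (<-≤-trans ρ<b b≤t) (sym (ℤ.+-injective (ℤ.i-j≡0⇒i≡j (+ t) (+ ρ) eq))))

enough-roots⇒zero : ∀ {k} (c : Fin k → ℤ) {b ts} → Ascending b ts → All (Root c) ts → k ≤ length ts →
  ∀ a → c a ≡ 0ℤ
enough-roots⇒zero {suc k} c (_∷_ {t = ρ} b≤ρ asc) (root ∷ roots) (s≤s k≤len) =
  quotient-zero c (+ ρ) root
    (enough-roots⇒zero (quotient c (+ ρ)) asc (roots-of-quotient c ρ root (n<1+n ρ) asc roots) k≤len)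

-- Homogeneous linear systems over the integers

module LinearSystem {X : Set} (_≟_ : DecidableEquality X) where

  record Functional : Set where
    field
      ⟪_⟫    : (X → ℤ) → ℤ
      linear : ∀ u w f g → ⟪_⟫ (λ x → u *ℤ f x +ℤ w *ℤ g x) ≡ u *ℤ ⟪_⟫ f +ℤ w *ℤ ⟪_⟫ g
  open Functional public

  δ : X → X → ℤ
  δ x y with x ≟ y
  ... | yes _ = 1ℤ
  ... | no _  = 0ℤ

  δ-refl : ∀ x → δ x x ≡ 1ℤ
  δ-refl x with x ≟ x
  ... | yes _  = refl
  ... | no x≢x = ⊥-elim (x≢x refl)

  δ-≢ : ∀ {x y} → x ≢ y → δ x y ≡ 0ℤ
  δ-≢ {x} {y} x≢y with x ≟ y
  ... | yes x≡y = ⊥-elim (x≢y x≡y)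
  ... | no _    = refl

  -- By linearity, the value of L at P(e) f − P(f) e, which lies in the kernel of P.
  eliminate : Functional → (X → ℤ) → Functional → Functional
  eliminate P e L .⟪_⟫ f = ⟪ P ⟫ e *ℤ ⟪ L ⟫ f +ℤ (- ⟪ L ⟫ e) *ℤ ⟪ P ⟫ f
  eliminate P e L .linear u w f g
    rewrite linear L u w f g | linear P u w f g =
    lemma (⟪ P ⟫ e) (⟪ L ⟫ e) u w (⟪ L ⟫ f) (⟪ L ⟫ g) (⟪ P ⟫ f) (⟪ P ⟫ g)
    where
    lemma : ∀ p l u w Lf Lg Pf Pg →
      p *ℤ (u *ℤ Lf +ℤ w *ℤ Lg) +ℤ (- l) *ℤ (u *ℤ Pf +ℤ w *ℤ Pg)
      ≡ u *ℤ (p *ℤ Lf +ℤ (- l) *ℤ Pf) +ℤ w *ℤ (p *ℤ Lg +ℤ (- l) *ℤ Pg)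
    lemma = solve-∀

  pivot? : ∀ e (Ls : List Functional) →
    All (λ L → ⟪ L ⟫ e ≡ 0ℤ) Ls ⊎
    (∃[ Ms ] ∃[ P ] ∃[ Ns ] (Ls ≡ Ms ++ P ∷ Ns × ⟪ P ⟫ e ≢ 0ℤ))
  pivot? e [] = inj₁ []
  pivot? e (L ∷ Ls) with ⟪ L ⟫ e ℤ.≟ 0ℤ
  ... | no L≢0 = inj₂ ([] , L , Ls , refl , L≢0)
  ... | yes L≡0 with pivot? e Ls
  ...   | inj₁ Ls≡0 = inj₁ (L≡0 ∷ Ls≡0)
  ...   | inj₂ (Ms , P , Ns , refl , P≢0) = inj₂ (L ∷ Ms , P , Ns , refl , P≢0)

  -- Gaussian elimination without division. If every equation vanishes on `δ x`, that is a solution.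
  -- Otherwise a pivot equation removes the unknown `x` and itself, and the induction hypothesis
  -- applies to the rest.
  nontrivial-solution : ∀ (xs : List X) (Ls : List Functional) → Unique xs → length Ls < length xs →
    ∃[ f ] ((∃[ x ] (x ∈ xs × f x ≢ 0ℤ)) × All (λ L → ⟪ L ⟫ f ≡ 0ℤ) Ls)
  nontrivial-solution (x ∷ xs) Ls (x∉xs ∷ unique) (s≤s len) with pivot? (δ x) Ls
  ... | inj₁ Ls≡0 = δ x , (x , here refl , 1≢0 ∘ trans (sym (δ-refl x))) , Ls≡0
    where
    1≢0 : 1ℤ ≢ 0ℤ
    1≢0 ()
  ... | inj₂ (Ms , P , Ns , refl , P≢0) =
    let g , (y , y∈xs , gy≢0) , solves = nontrivial-solution xs (map (eliminate P (δ x)) (Ms ++ Ns)) unique shorter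
        p = ⟪ P ⟫ (δ x)
        -- By `eliminate`, each remaining functional takes at `f` the value its eliminated form
        -- takes at `g`, which is 0; `P` itself cancels on `f`. As y differs from x, f y is the
        -- product of the nonzero numbers p and g y.
        f = λ z → p *ℤ g z +ℤ (- ⟪ P ⟫ g) *ℤ δ x z
        fy≢0 : f y ≢ 0ℤ
        fy≢0 = product≢0 P≢0 gy≢0 ∘ trans (sym (reduce p (g y) (⟪ P ⟫ g) (δ-≢ (All.lookup x∉xs y∈xs))))
        solve : ∀ L → ⟪ eliminate P (δ x) L ⟫ g ≡ 0ℤ → ⟪ L ⟫ f ≡ 0ℤ
        solve L eq = trans (linear L p (- ⟪ P ⟫ g) g (δ x))
                       (trans (rearrange p (⟪ L ⟫ g) (⟪ P ⟫ g) (⟪ L ⟫ (δ x))) eq)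
        solved = All.map (λ {L} → solve L) (All.map⁻ solves)
    in f , (y , there y∈xs , fy≢0) ,
       All.++⁺ (All.++⁻ˡ Ms solved)
               (trans (linear P p (- ⟪ P ⟫ g) g (δ x)) (cancel p (⟪ P ⟫ g)) ∷ All.++⁻ʳ Ms solved)
    where
    product≢0 : ∀ {i j} → i ≢ 0ℤ → j ≢ 0ℤ → i *ℤ j ≢ 0ℤ
    product≢0 {i} i≢0 j≢0 eq = [ i≢0 , j≢0 ]′ (ℤ.i*j≡0⇒i≡0∨j≡0 i eq)
    shorter : length (map (eliminate P (δ x)) (Ms ++ Ns)) < length xs
    shorter = ≤-trans (≤-reflexive (begin
      suc (length (map (eliminate P (δ x)) (Ms ++ Ns))) ≡⟨ cong suc (length-map _ (Ms ++ Ns)) ⟩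
      suc (length (Ms ++ Ns))                           ≡⟨ cong suc (length-++ Ms) ⟩
      suc (length Ms + length Ns)                       ≡⟨ +-suc (length Ms) (length Ns) ⟨
      length Ms + suc (length Ns)                       ≡⟨ length-++ Ms ⟨
      length (Ms ++ P ∷ Ns)                             ∎)) len
      where open ≡-Reasoning
    reduce : ∀ p g P {e} → e ≡ 0ℤ → p *ℤ g +ℤ (- P) *ℤ e ≡ p *ℤ g
    reduce p g P refl = lemma p g P
      where
      lemma : ∀ p g P → p *ℤ g +ℤ (- P) *ℤ 0ℤ ≡ p *ℤ g
      lemma = solve-∀
    rearrange : ∀ p Lg Pg Le → p *ℤ Lg +ℤ (- Pg) *ℤ Le ≡ p *ℤ Lg +ℤ (- Le) *ℤ Pg
    rearrange = solve-∀
    cancel : ∀ p Pg → p *ℤ Pg +ℤ (- Pg) *ℤ p ≡ 0ℤ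
    cancel = solve-∀

-- The polynomial method

∈-allVerts : ∀ {n d} (v : HVertex n d) → v ∈ allVerts n d
∈-allVerts []       = here refl
∈-allVerts (x ∷ xs) = ∈-concatMap⁺ _ (lose (∈-allFin x) (∈-map⁺ (x ∷_) (∈-allVerts xs)))

-- A symmetric polynomial in k variables of degree less than r in each is given by its coefficients z at the multisets of k
-- exponents; a multiset is its vector of multiplicities. Then contract x z substitutes x for one variable.
Exponent : ℕ → Set
Exponent r = Vec ℕ r

origin : ∀ {r} → Exponent r
origin = replicate _ 0

raise : ∀ {r} → Fin r → Exponent r → Exponent r
raise a α = updateAt α a suc

raise-comm : ∀ {r} (a b : Fin r) α → raise a (raise b α) ≡ raise b (raise a α)
raise-comm zero    zero    (e ∷ α) = refl
raise-comm zero    (suc b) (e ∷ α) = refl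
raise-comm (suc a) zero    (e ∷ α) = refl
raise-comm (suc a) (suc b) (e ∷ α) = cong (e ∷_) (raise-comm a b α)

raises : ∀ {r k} → Vec (Fin r) k → Exponent r → Exponent r
raises []      α = α
raises (a ∷ w) α = raise a (raises w α)

raises-raise : ∀ {r k} (w : Vec (Fin r) k) a α → raises w (raise a α) ≡ raise a (raises w α)
raises-raise []      a α = refl
raises-raise (b ∷ w) a α = trans (cong (raise b) (raises-raise w a α)) (raise-comm b a (raises w α))

module _ {r : ℕ} where

  contract : ℕ → (Exponent r → ℤ) → Exponent r → ℤ
  contract x z α = eval (λ a → z (raise a α)) (+ x)

  contract-cong : ∀ x {y z : Exponent r → ℤ} → (∀ α → y α ≡ z α) → ∀ α → contract x y α ≡ contract x z α
  contract-cong x y≗z α = eval-cong (λ a → y≗z (raise a α)) (+ x)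

  -- This is the symmetry of the polynomial: exponents form a multiset, so the order of two
  -- substitutions is immaterial.
  contract-comm : ∀ x y z α → contract x (contract y z) α ≡ contract y (contract x z) α
  contract-comm x y z α = begin
    eval (λ a → eval (λ b → z (raise b (raise a α))) (+ y)) (+ x)
      ≡⟨ eval-swap (λ a b → z (raise b (raise a α))) (+ x) (+ y) ⟩
    eval (λ b → eval (λ a → z (raise b (raise a α))) (+ x)) (+ y)
      ≡⟨ eval-cong (λ b → eval-cong (λ a → cong z (raise-comm b a α)) (+ x)) (+ y) ⟩
    eval (λ b → eval (λ a → z (raise a (raise b α))) (+ x)) (+ y) ∎
    where open ≡-Reasoning

  contractAll : ∀ {k} → Vec ℕ k → (Exponent r → ℤ) → Exponent r → ℤ
  contractAll []       z = z
  contractAll (x ∷ xs) z = contract x (contractAll xs z)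

  contractAll-linear : ∀ {k} (xs : Vec ℕ k) u w y z α →
    contractAll xs (λ β → u *ℤ y β +ℤ w *ℤ z β) α ≡ u *ℤ contractAll xs y α +ℤ w *ℤ contractAll xs z α
  contractAll-linear []       u w y z α = refl
  contractAll-linear (x ∷ xs) u w y z α =
    trans (contract-cong x (contractAll-linear xs u w y z) α)
          (eval-linear u w (λ a → contractAll xs y (raise a α)) (λ a → contractAll xs z (raise a α)) (+ x))

-- Edge labels and the propagation of vanishing

consIf : Bool → ℕ → List ℕ → List ℕ
consIf b t ts = if b then t ∷ ts else ts

-- The tail `ts` chains the coordinates together, so that the labels around a vertex form one
-- ascending list.
labelsBefore : ∀ {n} → (Fin n → Bool) → ℕ → List ℕ → List ℕ
labelsBefore {zero}  p b ts = ts
labelsBefore {suc n} p b ts = consIf (p zero) b (labelsBefore (p ∘ suc) (suc b) ts)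

length-labelsBefore : ∀ {n} (p : Fin n → Bool) b ts → length (labelsBefore p b ts) ≡ sum (bit ∘ p) + length ts
length-labelsBefore {zero}  p b ts = refl
length-labelsBefore {suc n} p b ts = begin
  length (consIf (p zero) b rest)                  ≡⟨ cons (p zero) ⟩
  bit (p zero) + length rest                       ≡⟨ cong₂ _+_ refl (length-labelsBefore (p ∘ suc) (suc b) ts) ⟩
  bit (p zero) + (sum (bit ∘ p ∘ suc) + length ts) ≡⟨ +-assoc (bit (p zero)) _ _ ⟨
  sum (bit ∘ p) + length ts                        ∎
  where
  open ≡-Reasoning
  rest = labelsBefore (p ∘ suc) (suc b) ts
  cons : ∀ q → length (consIf q b rest) ≡ bit q + length rest
  cons true  = refl
  cons false = refl

ascending-labelsBefore : ∀ {n} (p : Fin n → Bool) b {ts} → Ascending (b + n) ts → Ascending b (labelsBefore p b ts)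
ascending-labelsBefore {zero}  p b asc = subst (λ c → Ascending c _) (+-identityʳ b) asc
ascending-labelsBefore {suc n} p b {ts} asc
  with p zero | ascending-labelsBefore (p ∘ suc) (suc b) (subst (λ c → Ascending c ts) (+-suc b n) asc)
... | true  | asc′ = ≤-refl ∷ asc′
... | false | asc′ = Ascending-≤ (n≤1+n b) asc′

all-labelsBefore : ∀ {P : ℕ → Set} {n} (p : Fin n → Bool) b {ts} →
  (∀ y → p y ≡ true → P (b + toℕ y)) → All P ts → All P (labelsBefore p b ts)
all-labelsBefore     {n = zero}  p b h Pts = Pts
all-labelsBefore {P} {n = suc n} p b h Pts
  with p zero in eq | all-labelsBefore (p ∘ suc) (suc b) (λ y py → subst P (+-suc b (toℕ y)) (h (suc y) py)) Pts
... | true  | Prest = subst P (+-identityʳ b) (h zero eq) ∷ Prest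
... | false | Prest = Prest

-- The value y of coordinate i has label b + i n + y, so that distinct neighbours of a vertex have distinct labels.
encode : ∀ {n d} → ℕ → HVertex n d → Vec ℕ d
encode         b []       = []
encode {n = n} b (x ∷ xs) = b + toℕ x ∷ encode (b + n) xs

neighbourLabels : ∀ {n d} → ℕ → (HVertex n d → Bool) → HVertex n d → List ℕ
neighbourLabels         b p []       = []
neighbourLabels {n = n} b p (x ∷ xs) =
  labelsBefore (lineNeighbours x (λ y → p (y ∷ xs))) b (neighbourLabels (b + n) (p ∘ (x ∷_)) xs)

length-neighbourLabels : ∀ {n d} b p (v : HVertex n d) → length (neighbourLabels b p v) ≡ neighbours p v
length-neighbourLabels b p []       = refl
length-neighbourLabels b p (x ∷ xs) =
  trans (length-labelsBefore (lineNeighbours x (λ y → p (y ∷ xs))) b _)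
        (cong₂ _+_ refl (length-neighbourLabels _ (p ∘ (x ∷_)) xs))

ascending-neighbourLabels : ∀ {n d} b p (v : HVertex n d) → Ascending b (neighbourLabels b p v)
ascending-neighbourLabels b p []       = []
ascending-neighbourLabels b p (x ∷ xs) =
  ascending-labelsBefore (lineNeighbours x (λ y → p (y ∷ xs))) b (ascending-neighbourLabels _ (p ∘ (x ∷_)) xs)

lineNeighbours-true : ∀ {n} (x : Fin n) p {y} → lineNeighbours x p y ≡ true → p y ≡ true
lineNeighbours-true x p {y} eq with does (x Fin.≟ y)
... | false = eq

-- In use, `u` is v with one coordinate value replaced by the one labelled `t`, and `s` labels the
-- old value. Then v with t and u with s substitute the same labels, which makes the weight of the
-- edge well defined.
SharedEdge : ∀ {n d} → ℕ → ℕ → (HVertex n d → Bool) → HVertex n d → ℕ → Set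
SharedEdge r b p v t = ∃[ u ] ∃[ s ] (p u ≡ true ×
  (∀ (z : Exponent r → ℤ) α →
    contract t (contractAll (encode b v) z) α ≡ contract s (contractAll (encode b u) z) α))

shared-neighbourLabels : ∀ {n d} r b p (v : HVertex n d) → All (SharedEdge r b p v) (neighbourLabels b p v)
shared-neighbourLabels         r b p []       = []
shared-neighbourLabels {n = n} r b p (x ∷ xs) =
  all-labelsBefore (lineNeighbours x (λ y → p (y ∷ xs))) b
    (λ y eq → y ∷ xs , b + toℕ x , lineNeighbours-true x (λ y′ → p (y′ ∷ xs)) eq ,
      λ z α → contract-comm (b + toℕ y) (b + toℕ x) (contractAll (encode (b + n) xs) z) α)
    (All.map (λ {t} (u , s , pu , swap) → x ∷ u , s , pu , λ z α →
        trans (contract-comm t (b + toℕ x) (contractAll (encode (b + n) xs) z) α)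
        (trans (contract-cong (b + toℕ x) (swap z) α)
               (contract-comm (b + toℕ x) s (contractAll (encode (b + n) u) z) α)))
      (shared-neighbourLabels r (b + n) (p ∘ (x ∷_)) xs))

-- With the later coordinates fixed, the polynomial in the first variable vanishes at n ≥ r labels,
-- so each of its r coefficients vanishes. These are polynomials on the smaller grid, and `α`
-- collects the exponents already chosen.
grid-vanishing : ∀ {r n k} → r ≤ n → ∀ b (z : Exponent r → ℤ) α →
  (∀ (v : HVertex n k) → contractAll (encode b v) z α ≡ 0ℤ) → ∀ (w : Vec (Fin r) k) → z (raises w α) ≡ 0ℤ
grid-vanishing               r≤n b z α vanish []      = vanish []
grid-vanishing {r} {n} {suc k} r≤n b z α vanish (a ∷ w) =
  trans (cong z (sym (raises-raise w a α)))
        (grid-vanishing r≤n (b + n) z (raise a α) (λ xs → coefficient xs a) w)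
  where
  coefficient : ∀ (xs : HVertex n k) a → contractAll (encode (b + n) xs) z (raise a α) ≡ 0ℤ
  coefficient xs = enough-roots⇒zero _
    (ascending-labelsBefore {n} (λ _ → true) b [])
    (all-labelsBefore (λ _ → true) b (λ y _ → vanish (y ∷ xs)) [])
    (≤-trans r≤n (≤-reflexive (sym
      (trans (length-labelsBefore {n} (λ _ → true) b []) (trans (+-identityʳ _) (sum-1 n))))))
    where
    sum-1 : ∀ n → sum {n} (λ _ → 1) ≡ n
    sum-1 zero    = refl
    sum-1 (suc n) = cong suc (sum-1 n)

-- One variable is left after the d substitutions; its coefficients all vanish, that is, Q(v, ·) =
-- 0.
Trivial : ∀ {n d r} → (Exponent r → ℤ) → HVertex n d → Set
Trivial z v = ∀ a → contractAll (encode 0 v) z (raise a origin) ≡ 0ℤ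

module _ {n d r : ℕ} (A : HVertex n d → Bool) (z : Exponent r → ℤ) where

  open Bootstrap (allVerts n d) hammingAdj

  active⇒trivial : (∀ v → A v ≡ true → Trivial z v) → ∀ i v → active r A i v ≡ true → Trivial z v
  active⇒trivial initial zero    v Av = initial v Av
  active⇒trivial initial (suc i) v Av
    with active r A i v in old | r ≤ᵇ count (λ u → hammingAdj v u ∧ active r A i u) (allVerts n d) in new
  ... | true  | _    = active⇒trivial initial i v old
  -- Here `v` is newly activated: its active neighbours give at least r distinct roots of a
  -- polynomial with r coefficients.
  ... | false | true = enough-roots⇒zero _ (ascending-neighbourLabels 0 (active r A i) v)
    (All.map root (shared-neighbourLabels r 0 (active r A i) v))
    (subst (r ≤_) (trans (count-adj v (active r A i)) (sym (length-neighbourLabels 0 (active r A i) v)))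
           (≤ᵇ⇒≤ r _ (Equivalence.from Bool.T-≡ new)))
    where
    root : ∀ {t} → SharedEdge r 0 (active r A i) v t →
           Root (λ a → contractAll (encode 0 v) z (raise a origin)) t
    root (u , s , Au , shared) = trans (shared z origin)
      (trans (eval-cong (active⇒trivial initial i u Au) (+ s)) (eval-0 {r} (+ s)))

-- The number of unknowns

multisets : (r k : ℕ) → List (Exponent r)
multisets zero    zero    = [] ∷ []
multisets zero    (suc k) = []
multisets (suc r) zero    = map (0 ∷_) (multisets r 0)
multisets (suc r) (suc k) = map (raise zero) (multisets (suc r) k) ++ map (0 ∷_) (multisets r (suc k))

-- Pascal's rule: a nonempty multiset either contains the exponent 0, and one copy is removed, or
-- avoids it, and one exponent fewer is available.
length-multisets : ∀ r k → length (multisets (suc r) k) ≡ (r + k) C k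
length-multisets zero    zero    = refl
length-multisets (suc r) zero    = trans (length-map _ (multisets (suc r) 0)) (length-multisets r zero)
length-multisets zero    (suc k) = begin
  length (map (raise zero) (multisets 1 k) ++ []) ≡⟨ length-++ (map (raise zero) (multisets 1 k)) ⟩
  length (map (raise zero) (multisets 1 k)) + 0   ≡⟨ +-identityʳ _ ⟩
  length (map (raise zero) (multisets 1 k))       ≡⟨ length-map _ (multisets 1 k) ⟩
  length (multisets 1 k)                          ≡⟨ length-multisets zero k ⟩
  k C k                                           ≡⟨ nCn≡1 k ⟩
  1                                               ≡⟨ nCn≡1 (suc k) ⟨
  suc k C suc k                                   ∎
  where open ≡-Reasoning
length-multisets (suc r) (suc k) = begin
  length (map (raise zero) (multisets (2 + r) k) ++ map (0 ∷_) (multisets (suc r) (suc k)))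
    ≡⟨ length-++ (map (raise zero) (multisets (2 + r) k)) ⟩
  length (map (raise zero) (multisets (2 + r) k)) + length (map (0 ∷_) (multisets (suc r) (suc k)))
    ≡⟨ cong₂ _+_ (trans (length-map _ (multisets (2 + r) k)) (length-multisets (suc r) k))
                 (trans (length-map _ (multisets (suc r) (suc k))) (length-multisets r (suc k))) ⟩
  (suc r + k) C k + (r + suc k) C suc k
    ≡⟨ cong (λ m → m C k + (r + suc k) C suc k) (+-suc r k) ⟨
  (r + suc k) C k + (r + suc k) C suc k
    ≡⟨ nCk+nC[k+1]≡[n+1]C[k+1] (r + suc k) k ⟩
  (suc r + suc k) C suc k ∎
  where open ≡-Reasoning

unique-multisets : ∀ r k → Unique (multisets r k)
unique-multisets zero    zero    = [] ∷ []
unique-multisets zero    (suc k) = []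
unique-multisets (suc r) zero    = Unique.map⁺ Vec.∷-injectiveʳ (unique-multisets r zero)
unique-multisets (suc r) (suc k) =
  Unique.++⁺ (Unique.map⁺ raise-injective (unique-multisets (suc r) k))
             (Unique.map⁺ Vec.∷-injectiveʳ (unique-multisets r (suc k)))
             (λ (∈raised , ∈zero) → disjoint (∈-map⁻ (raise zero) ∈raised) (∈-map⁻ (0 ∷_) ∈zero))
  where
  raise-injective : ∀ {α β : Exponent (suc r)} → raise zero α ≡ raise zero β → α ≡ β
  raise-injective {_ ∷ _} {_ ∷ _} refl = refl
  disjoint : ∀ {α} → ∃[ β ] (β ∈ multisets (suc r) k × α ≡ raise zero β) →
             ¬ (∃[ γ ] (γ ∈ multisets r (suc k) × α ≡ 0 ∷ γ))
  disjoint (_ ∷ _ , _ , refl) (_ , _ , ())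

raises-suc : ∀ {r k} (w : Vec (Fin r) k) e α → raises (Vec.map suc w) (e ∷ α) ≡ e ∷ raises w α
raises-suc []      e α = refl
raises-suc (a ∷ w) e α = cong (raise (suc a)) (raises-suc w e α)

-- Listing the members of a multiset one by one gives the form in which `grid-vanishing` reads off
-- coefficients.
multisets-raises : ∀ r k → All (λ α → ∃[ w ] (α ≡ raises {r} {k} w origin)) (multisets r k)
multisets-raises zero    zero    = ([] , refl) ∷ []
multisets-raises zero    (suc k) = []
multisets-raises (suc r) zero    = All.map⁺ (All.map (λ { ([] , refl) → [] , refl }) (multisets-raises r zero))
multisets-raises (suc r) (suc k) = All.++⁺
  (All.map⁺ (All.map (λ (w , eq) → zero ∷ w , cong (raise zero) eq) (multisets-raises (suc r) k)))
  (All.map⁺ (All.map (λ (w , eq) → Vec.map suc w , trans (cong (0 ∷_) eq) (sym (raises-suc w 0 origin)))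
                     (multisets-raises r (suc k))))

-- The equations Q(v, ·) = 0 and the lower bound

module _ {n d r : ℕ} where

  open LinearSystem (Vec.≡-dec {n = r} _≟_)

  equation : HVertex n d → Fin r → Functional
  equation v a .⟪_⟫ z          = contractAll (encode 0 v) z (raise a origin)
  equation v a .linear u w y z = contractAll-linear (encode 0 v) u w y z (raise a origin)

  equations : (HVertex n d → Bool) → List (HVertex n d) → List Functional
  equations A []       = []
  equations A (v ∷ vs) = (if A v then tabulate (equation v) else []) ++ equations A vs

  length-equations : ∀ A vs → length (equations A vs) ≡ r * count A vs
  length-equations A []       = sym (*-zeroʳ r)
  length-equations A (v ∷ vs) = begin
    length ((if A v then tabulate (equation v) else []) ++ equations A vs)
      ≡⟨ length-++ (if A v then tabulate (equation v) else []) ⟩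
    length (if A v then tabulate (equation v) else []) + length (equations A vs)
      ≡⟨ cong₂ _+_ (block (A v)) (length-equations A vs) ⟩
    r * bit (A v) + r * count A vs
      ≡⟨ *-distribˡ-+ r (bit (A v)) (count A vs) ⟨
    r * count A (v ∷ vs) ∎
    where
    open ≡-Reasoning
    block : ∀ q → length (if q then tabulate (equation v) else []) ≡ r * bit q
    block true  = trans (length-tabulate (equation v)) (sym (*-identityʳ r))
    block false = sym (*-zeroʳ r)

  equations-trivial : ∀ A z vs → All (λ L → ⟪ L ⟫ z ≡ 0ℤ) (equations A vs) →
    ∀ {v} → v ∈ vs → A v ≡ true → Trivial z v
  equations-trivial A z (v ∷ vs) solves (here refl) Av a rewrite Av =
    All.tabulate⁻ (All.++⁻ˡ (tabulate (equation v)) solves) a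
  equations-trivial A z (u ∷ vs) solves (there v∈vs) Av =
    equations-trivial A z vs (All.++⁻ʳ (if A u then tabulate (equation u) else []) solves) v∈vs Av

percolating-lower-bound : ∀ {n d r} → suc r ≤ n → (A : HVertex n d → Bool) →
  Bootstrap.Percolating (allVerts n d) hammingAdj (suc r) A →
  (d + suc r) C (d + 1) ≤ suc r * count A (allVerts n d)
percolating-lower-bound {n} {d} {r′} r≤n A percolates = ≮⇒≥ too-few
  where
  r = suc r′
  open LinearSystem (Vec.≡-dec {n = r} _≟_)
  unknowns : (d + r) C (d + 1) ≡ length (multisets r (suc d))
  unknowns = begin
    (d + suc r′) C (d + 1)     ≡⟨ cong₂ _C_ (trans (+-comm d (suc r′)) (sym (+-suc r′ d))) (+-comm d 1) ⟩
    (r′ + suc d) C suc d       ≡⟨ length-multisets r′ (suc d) ⟨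
    length (multisets r (suc d)) ∎
    where open ≡-Reasoning
  too-few : ¬ (r * count A (allVerts n d) < (d + r) C (d + 1))
  too-few fewer
    with z , (α , α∈ , zα≢0) , solves ← nontrivial-solution (multisets r (suc d)) (equations A (allVerts n d))
           (unique-multisets r (suc d))
           (subst₂ _<_ (sym (length-equations A (allVerts n d))) unknowns fewer)
    -- The d + 1 exponents of the nonzero coefficient are split: `a` belongs to the free variable of
    -- Q(v, ·), and `w` to the d grid coordinates.
    with a ∷ w , α≡ ← All.lookup (multisets-raises r (suc d)) α∈
    = zα≢0 (trans (cong z (trans α≡ (sym (raises-raise w a origin))))
                  (grid-vanishing r≤n 0 z (raise a origin) (λ v → trivial v a) w))
    where
    trivial : ∀ v → Trivial z v
    trivial v = active⇒trivial A z
      (λ u → equations-trivial A z (allVerts n d) solves (∈-allVerts u))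
      (proj₁ (percolates v)) v (proj₂ (percolates v))

-- The percolating set of the upper bound

-- A form of s ≤ E ∧ d ∣ E − s that is free of truncated subtraction.
level : ℕ → ℕ → ℕ → Bool
level d E       zero    = does (d ∣? E)
level d zero    (suc s) = false
level d (suc E) (suc s) = level d E s

level-∸ : ∀ d {E s} → s ≤ E → level d E s ≡ does (d ∣? (E ∸ s))
level-∸ d             z≤n       = refl
level-∸ d {suc E} {suc s} (s≤s s≤E) = level-∸ d s≤E

multiplesBelow : ℕ → ℕ → ℕ
multiplesBelow d zero    = 0
multiplesBelow d (suc E) = bit (does (d ∣? E)) + multiplesBelow d E

-- The two inequalities say that the number of multiples of d below E is ⌈E/d⌉.
multiplesBelow-bounds : ∀ d .{{_ : NonZero d}} E →
  E ≤ multiplesBelow d E * d × multiplesBelow d E * d < E + d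
multiplesBelow-bounds d zero = z≤n , ℕ.>-nonZero⁻¹ d
multiplesBelow-bounds d (suc E)
  with lower , upper ← multiplesBelow-bounds d E
  with d ∣? E
... | yes (divides-refl q) = subst (λ f → suc (q * d) ≤ d + f * d × d + f * d < suc (q * d) + d) (sym f≡q)
    (+-monoˡ-≤ (q * d) (ℕ.>-nonZero⁻¹ d) , s≤s (≤-reflexive (+-comm d (q * d))))
  where
  -- At an exact multiple E = q d the bounds leave only the value q, and the count grows; elsewhere
  -- the lower bound is strict and the count may stay.
  f≡q : multiplesBelow d (q * d) ≡ q
  f≡q = ≤-antisym (m<1+n⇒m≤n (*-cancelʳ-< d _ (suc q) (subst (multiplesBelow d (q * d) * d <_) (+-comm (q * d) d) upper)))
                  (*-cancelʳ-≤ q _ d lower)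
... | no d∤E = ≤∧≢⇒< lower (d∤E ∘ divides (multiplesBelow d E)) , m<n⇒m<1+n upper

vsum : ∀ {n d} → HVertex n d → ℕ
vsum []       = 0
vsum (x ∷ xs) = toℕ x + vsum xs

seed : ∀ {n d} → ℕ → HVertex n d → Bool
seed {d = d} E v = level d E (vsum v)

bit-mono : ∀ {b c} → (b ≡ true → c ≡ true) → bit b ≤ bit c
bit-mono {false} b⇒c = z≤n
bit-mono {true}  b⇒c rewrite b⇒c refl = ≤-refl

-- Position y has coordinate sum c + 1 + y. Since r ≤ c + n, the difference of r and this sum runs
-- through every number below r - c before the line ends.
multiplesBelow≤line : ∀ {n} d r c (p : Fin n → Bool) → r ≤ c + n →
  (∀ y → level d r (suc (c + toℕ y)) ≡ true → p y ≡ true) → multiplesBelow d (r ∸ c) ≤ sum (bit ∘ p)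
multiplesBelow≤line {zero} d r c p r≤ h
  rewrite m≤n⇒m∸n≡0 (subst (r ≤_) (+-identityʳ c) r≤) = z≤n
multiplesBelow≤line {suc n} d r c p r≤ h with r ℕ.≤? c
... | yes r≤c rewrite m≤n⇒m∸n≡0 r≤c = z≤n
... | no r≰c rewrite +-∸-assoc 1 (≰⇒> r≰c) =
    +-mono-≤ (bit-mono (h zero ∘ trans (cong (level d r ∘ suc) (+-identityʳ c)) ∘ trans (level-∸ d (≰⇒> r≰c))))
             (multiplesBelow≤line d r (suc c) (p ∘ suc) (subst (r ≤_) (+-suc c n) r≤)
               (λ y → h (suc y) ∘ trans (cong (level d r ∘ suc) (+-suc c (toℕ y)))))

-- The values below `x` are all active, and those above it include the seeds. Stripping a value from
-- the front of the line raises `c` by one.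
line-lower-bound : ∀ {n} d r c (x : Fin n) (p : Fin n → Bool) → r < c + n →
  (∀ y → toℕ y < toℕ x → p y ≡ true) →
  (∀ y → level d r (c + toℕ y) ≡ true → p y ≡ true) →
  toℕ x + multiplesBelow d (r ∸ (c + toℕ x)) ≤ sum (bit ∘ lineNeighbours x p)
line-lower-bound {suc n} d r c zero p r< below above rewrite +-identityʳ c =
  multiplesBelow≤line d r c (p ∘ suc) (≤-pred (subst (suc r ≤_) (+-suc c n) r<))
    (λ y → above (suc y) ∘ trans (cong (level d r) (+-suc c (toℕ y))))
line-lower-bound {suc n} d r c (suc x) p r< below above
  rewrite below zero (s≤s z≤n) | +-suc c (toℕ x) =
  s≤s (line-lower-bound d r (suc c) x (p ∘ suc) (subst (r <_) (+-suc c n) r<)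
         (λ y y<x → below (suc y) (s≤s y<x))
         (λ y → above (suc y) ∘ trans (cong (level d r) (+-suc c (toℕ y)))))

-- `b` is the sum of the coordinates already removed. The number of seeds found above v on a line
-- depends only on the full sum b + vsum v, so each of the k lines contributes the same amount.
neighbours-lower-bound : ∀ {n k} d r b (v : HVertex n k) (p : HVertex n k → Bool) → r < n →
  (∀ u → vsum u < vsum v → p u ≡ true) →
  (∀ u → level d r (b + vsum u) ≡ true → p u ≡ true) →
  vsum v + k * multiplesBelow d (r ∸ (b + vsum v)) ≤ neighbours p v
neighbours-lower-bound d r b [] p r<n below above = z≤n
neighbours-lower-bound {n} {suc k} d r b (x ∷ xs) p r<n below above = begin
  (toℕ x + vsum xs) + (f + k * f)   ≡⟨ shuffle (toℕ x) (vsum xs) f (k * f) ⟩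
  (toℕ x + f) + (vsum xs + k * f)   ≤⟨ +-mono-≤ line rest ⟩
  neighbours p (x ∷ xs)             ∎
  where
  open ≤-Reasoning
  f = multiplesBelow d (r ∸ (b + (toℕ x + vsum xs)))
  shuffle : ∀ a s f g → (a + s) + (f + g) ≡ (a + f) + (s + g)
  shuffle = solve-∀ⁿ
  swap : ∀ y → b + vsum xs + y ≡ b + (y + vsum xs)
  swap y = trans (+-assoc b _ y) (cong (λ m → b + m) (+-comm (vsum xs) y))
  line : toℕ x + f ≤ sum (bit ∘ lineNeighbours x (λ y → p (y ∷ xs)))
  line = subst (λ s → toℕ x + multiplesBelow d (r ∸ s) ≤ sum (bit ∘ lineNeighbours x (λ y → p (y ∷ xs)))) (swap (toℕ x))
    (line-lower-bound d r (b + vsum xs) x (λ y → p (y ∷ xs)) (<-≤-trans r<n (m≤n+m n _))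
      (λ y y<x → below (y ∷ xs) (+-monoˡ-< (vsum xs) y<x))
      (λ y → above (y ∷ xs) ∘ trans (cong (level d r) (sym (swap (toℕ y))))))
  rest : vsum xs + k * f ≤ neighbours (p ∘ (x ∷_)) xs
  rest = subst (λ s → vsum xs + k * multiplesBelow d (r ∸ s) ≤ neighbours (p ∘ (x ∷_)) xs) (+-assoc b (toℕ x) (vsum xs))
    (neighbours-lower-bound d r (b + toℕ x) xs (p ∘ (x ∷_)) r<n
      (λ u u<xs → below (x ∷ u) (+-monoʳ-< (toℕ x) u<xs))
      (λ u → above (x ∷ u) ∘ trans (cong (level d r) (sym (+-assoc b (toℕ x) (vsum u))))))

module _ {V : Set} (verts : List V) (adj : V → V → Bool) where
  open Bootstrap verts adj

  step-extensive : ∀ r A v → A v ≡ true → step r A v ≡ true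
  step-extensive r A v Av rewrite Av = refl

  active-initial : ∀ r A i v → A v ≡ true → active r A i v ≡ true
  active-initial r A zero    v Av = Av
  active-initial r A (suc i) v Av = step-extensive r (active r A i) v (active-initial r A i v Av)

-- Here the threshold is r + 1. A non-seed vertex of sum s ≤ r has ⌈(r − s)/d⌉ seeds of larger sum on each of its d lines;
-- as d does not divide r − s, they and the s neighbours of smaller sum are more than r.
module _ {n d : ℕ} .{{_ : NonZero d}} (r : ℕ) (r<n : r < n) where
  open Bootstrap (allVerts n d) hammingAdj

  seed-round : ∀ v → (∀ u → vsum u < vsum v → active (suc r) (seed r) (vsum v) u ≡ true) →
    active (suc r) (seed r) (suc (vsum v)) v ≡ true
  seed-round v smaller-active with level d r (vsum v) in isSeed
  ... | true  = active-initial (allVerts n d) hammingAdj (suc r) (seed r) (suc (vsum v)) v isSeed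
  ... | false = trans (cong (active (suc r) (seed r) i v ∨_) (Equivalence.to Bool.T-≡ (≤⇒≤ᵇ enough))) (Bool.∨-zeroʳ _)
    where
    i = vsum v
    f = multiplesBelow d (r ∸ i)
    r<i+d*f : r < i + d * f
    r<i+d*f with r ℕ.<? i
    -- Beyond sum r the neighbours of smaller sum suffice.
    ... | yes r<i = ≤-trans r<i (m≤m+n i _)
    ... | no r≮i = begin-strict
      r             ≡⟨ m+[n∸m]≡n i≤r ⟨
      i + (r ∸ i)   <⟨ +-monoʳ-< i (≤∧≢⇒< (proj₁ (multiplesBelow-bounds d (r ∸ i))) not-multiple) ⟩
      i + f * d     ≡⟨ cong (λ m → i + m) (*-comm f d) ⟩
      i + d * f     ∎
      where
      open ≤-Reasoning
      i≤r = ≮⇒≥ r≮i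
      not-multiple : r ∸ i ≢ f * d
      not-multiple eq with d ∣? (r ∸ i) | trans (sym (level-∸ d i≤r)) isSeed
      ... | no d∤ | _ = d∤ (divides f eq)
    enough : suc r ≤ count (λ u → hammingAdj v u ∧ active (suc r) (seed r) i u) (allVerts n d)
    enough = begin
      suc r              ≤⟨ r<i+d*f ⟩
      vsum v + d * f     ≤⟨ neighbours-lower-bound d r 0 v (active (suc r) (seed r) i) r<n smaller-active
                              (λ u → active-initial (allVerts n d) hammingAdj (suc r) (seed r) i u) ⟩
      neighbours (active (suc r) (seed r) i) v ≡⟨ count-adj v (active (suc r) (seed r) i) ⟨
      count (λ u → hammingAdj v u ∧ active (suc r) (seed r) i u) (allVerts n d) ∎
      where open ≤-Reasoning

  -- Vertices of sum s are active after s + 1 rounds: those of smaller sum precede them, and seeds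
  -- of larger sum are present from the start.
  seed-active : ∀ i v → vsum v < i → active (suc r) (seed r) i v ≡ true
  seed-active (suc i) v (s≤s v≤i) with m≤n⇒m<n∨m≡n v≤i
  ... | inj₁ v<i = step-extensive (allVerts n d) hammingAdj (suc r) (active (suc r) (seed r) i) v (seed-active i v v<i)
  ... | inj₂ v≡i = subst (λ j → active (suc r) (seed r) (suc j) v ≡ true) v≡i (seed-round v
          (subst (λ j → ∀ u → vsum u < j → active (suc r) (seed r) j u ≡ true) (sym v≡i) (seed-active i)))

  seed-percolating : Percolating (suc r) (seed r)
  seed-percolating v = suc (vsum v) , seed-active (suc (vsum v)) v ≤-refl

-- The number of v ∈ ℕᵏ with coordinate sum s ≤ E and d ∣ E − s.
prefixSums : ℕ → ℕ → ℕ → ℕ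
prefixSums d zero    E       = bit (does (d ∣? E))
prefixSums d (suc k) zero    = prefixSums d k zero
prefixSums d (suc k) (suc E) = prefixSums d k (suc E) + prefixSums d (suc k) E

-- An inequality, because coordinates in the grid stay below n while `prefixSums` admits all of ℕ.
count-level : ∀ d n k E → count (λ v → level d E (vsum v)) (allVerts n k) ≤ prefixSums d k E
count-level d n zero    E = ≤-reflexive (+-identityʳ _)
count-level d n (suc k) E = ≤-trans (≤-reflexive (count-allVerts n k (λ v → level d E (vsum v)))) (slices n E)
  where
  slice : ℕ → ℕ → ℕ
  slice E x = count (λ xs → level d E (x + vsum xs)) (allVerts n k)
  slices : ∀ m E → sum {m} (slice E ∘ toℕ) ≤ prefixSums d (suc k) E
  slices zero    E       = z≤n
  slices (suc m) zero    = begin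
    slice 0 0 + sum {m} (slice 0 ∘ suc ∘ toℕ)
      ≡⟨ cong₂ _+_ refl (trans (sum-cong-≗ {m} (λ _ → count-false (allVerts n k))) (sum-replicate-zero m)) ⟩
    slice 0 0 + 0                             ≡⟨ +-identityʳ _ ⟩
    slice 0 0                                 ≤⟨ count-level d n k 0 ⟩
    prefixSums d k 0                          ∎
    where open ≤-Reasoning
  slices (suc m) (suc E) = +-mono-≤ (count-level d n k (suc E)) (slices m E)

prefixSums-1 : ∀ d E → prefixSums d 1 E ≡ multiplesBelow d (suc E)
prefixSums-1 d zero    = sym (+-identityʳ _)
prefixSums-1 d (suc E) = cong₂ _+_ refl (prefixSums-1 d E)

-- The two leading terms of the binomial expansion of (z + 1)^(k + 1).
power-step : ∀ z k → suc k * z ℕ.^ k + z ℕ.^ suc k ≤ suc z ℕ.^ suc k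
power-step z zero    = ≤-reflexive (lemma z)
  where
  lemma : ∀ z → 1 + z * 1 ≡ suc z * 1
  lemma = solve-∀ⁿ
power-step z (suc k) = begin
  suc (suc k) * (z * P) + z * (z * P)       ≤⟨ m≤m+n _ (suc k * P) ⟩
  (suc (suc k) * (z * P) + z * (z * P)) + suc k * P   ≡⟨ lemma z P k ⟩
  suc z * (suc k * P + z * P)               ≤⟨ *-monoʳ-≤ (suc z) (power-step z k) ⟩
  suc z * suc z ℕ.^ suc k                   ∎
  where
  open ≤-Reasoning
  P = z ℕ.^ k
  lemma : ∀ z P k → ((2 + k) * (z * P) + z * (z * P)) + (1 + k) * P ≡ (1 + z) * ((1 + k) * P + z * P)
  lemma = solve-∀ⁿ

-- Induction along the recursion of `prefixSums`. Both summands are bounded by powers of the same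
-- base, and `power-step` combines them at the cost of raising that base by one.
prefixSums-bound : ∀ d .{{_ : NonZero d}} k E → suc k ! * (d * prefixSums d (suc k) E) ≤ (k + E + d) ℕ.^ suc k
prefixSums-bound d zero    E = begin
  1 * (d * prefixSums d 1 E)       ≡⟨ *-identityˡ _ ⟩
  d * prefixSums d 1 E             ≡⟨ cong (d *_) (prefixSums-1 d E) ⟩
  d * multiplesBelow d (suc E)     ≡⟨ *-comm d _ ⟩
  multiplesBelow d (suc E) * d     ≤⟨ ≤-pred (proj₂ (multiplesBelow-bounds d (suc E))) ⟩
  E + d                            ≡⟨ *-identityʳ _ ⟨
  (E + d) * 1                      ∎
  where open ≤-Reasoning
prefixSums-bound d (suc k) zero    = begin
  (2 + k) * suc k ! * (d * prefixSums d (suc k) 0)    ≡⟨ *-assoc (2 + k) (suc k !) _ ⟩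
  (2 + k) * (suc k ! * (d * prefixSums d (suc k) 0))  ≤⟨ *-monoʳ-≤ (2 + k) (prefixSums-bound d k 0) ⟩
  (2 + k) * (k + 0 + d) ℕ.^ suc k                     ≤⟨ m≤m+n _ _ ⟩
  (2 + k) * (k + 0 + d) ℕ.^ suc k + (k + 0 + d) ℕ.^ (2 + k) ≤⟨ power-step (k + 0 + d) (suc k) ⟩
  (suc k + 0 + d) ℕ.^ (2 + k)                         ∎
  where open ≤-Reasoning
prefixSums-bound d (suc k) (suc E) = begin
  (2 + k) * suc k ! * (d * (P + Q))                        ≡⟨ distribute (2 + k) (suc k !) d P Q ⟩
  (2 + k) * (suc k ! * (d * P)) + (2 + k) * suc k ! * (d * Q)
    ≤⟨ +-mono-≤ (*-monoʳ-≤ (2 + k) (prefixSums-bound d k (suc E))) (prefixSums-bound d (suc k) E) ⟩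
  (2 + k) * (k + suc E + d) ℕ.^ suc k + (suc k + E + d) ℕ.^ (2 + k)
    ≡⟨ cong (λ z → (2 + k) * (k + suc E + d) ℕ.^ suc k + (z + d) ℕ.^ (2 + k)) (+-suc k E) ⟨
  (2 + k) * (k + suc E + d) ℕ.^ suc k + (k + suc E + d) ℕ.^ (2 + k)
    ≤⟨ power-step (k + suc E + d) (suc k) ⟩
  (suc k + suc E + d) ℕ.^ (2 + k) ∎
  where
  open ≤-Reasoning
  P = prefixSums d (suc k) (suc E)
  Q = prefixSums d (2 + k) E
  distribute : ∀ a b d P Q → a * b * (d * (P + Q)) ≡ a * (b * (d * P)) + a * b * (d * Q)
  distribute = solve-∀ⁿ

seed-size : ∀ n d .{{_ : NonZero d}} r → d ! * (d * count (seed {n} {d} r) (allVerts n d)) ≤ (d ∸ 1 + r + d) ℕ.^ d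
seed-size n d@(suc k) r = ≤-trans (*-monoʳ-≤ (d !) (*-monoʳ-≤ d (count-level d n d r))) (prefixSums-bound d k r)

-- Existence of a minimum percolating set

module _ {V : Set} where

  count-mono : {p q : V → Bool} → (∀ v → p v ≡ true → q v ≡ true) → ∀ vs → count p vs ≤ count q vs
  count-mono p⇒q []       = z≤n
  count-mono p⇒q (v ∷ vs) = +-mono-≤ (bit-mono (p⇒q v)) (count-mono p⇒q vs)

  count-mono-< : {p q : V → Bool} → (∀ v → p v ≡ true → q v ≡ true) → ∀ {vs} → Any (λ v → q v ≢ p v) vs →
    count p vs < count q vs
  count-mono-< {p} {q} p⇒q {v ∷ vs} (here q≢p) with p v in pv | q v in qv
  ... | true  | true  = ⊥-elim (q≢p refl)
  ... | true  | false = ⊥-elim (q≢p (trans (sym qv) (p⇒q v pv)))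
  ... | false | true  = s≤s (count-mono p⇒q vs)
  ... | false | false = ⊥-elim (q≢p refl)
  count-mono-< p⇒q {v ∷ vs} (there any) = +-mono-≤-< (bit-mono (p⇒q v)) (count-mono-< p⇒q any)

  count≤length : ∀ (p : V → Bool) vs → count p vs ≤ length vs
  count≤length p []       = z≤n
  count≤length p (v ∷ vs) = +-mono-≤ (bit≤1 (p v)) (count≤length p vs)
    where
    bit≤1 : ∀ b → bit b ≤ 1
    bit≤1 true  = ≤-refl
    bit≤1 false = z≤n

module _ {V : Set} (_≟_ : DecidableEquality V) where

  assign : V → Bool → (V → Bool) → V → Bool
  assign v b A u = if does (u ≟ v) then b else A u

  -- Agreement on the listed vertices takes the place of equality of functions: every predicate
  -- agrees there with one of these.
  predicates : List V → List (V → Bool)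
  predicates []       = (λ _ → false) ∷ []
  predicates (v ∷ vs) = concatMap (λ A → assign v true A ∷ assign v false A ∷ []) (predicates vs)

  predicates-complete : ∀ (A : V → Bool) vs → ∃[ B ] (B ∈ predicates vs × (∀ {v} → v ∈ vs → B v ≡ A v))
  predicates-complete A []       = (λ _ → false) , here refl , λ ()
  predicates-complete A (v ∷ vs) with B , B∈ , agree ← predicates-complete A vs =
    assign v (A v) B , ∈-concatMap⁺ _ (lose B∈ (member (A v))) , agree′
    where
    member : ∀ b → assign v b B ∈ assign v true B ∷ assign v false B ∷ []
    member true  = here refl
    member false = there (here refl)
    agree′ : ∀ {u} → u ∈ v ∷ vs → assign v (A v) B u ≡ A u
    agree′ {u} u∈ with u ≟ v | u∈
    ... | yes refl | _         = refl
    ... | no u≢v   | here u≡v  = ⊥-elim (u≢v u≡v)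
    ... | no _     | there u∈vs = agree u∈vs

module Minimum {V : Set} (_≟_ : DecidableEquality V) (verts : List V) (complete : ∀ v → v ∈ verts)
               (adj : V → V → Bool) (r : ℕ) where

  open Bootstrap verts adj

  step-cong : ∀ {A B} → (∀ v → A v ≡ B v) → ∀ v → step r A v ≡ step r B v
  step-cong A≗B v = cong₂ _∨_ (A≗B v) (cong (r ≤ᵇ_) (count-cong (λ u → cong (adj v u ∧_) (A≗B u)) verts))

  active-cong : ∀ {A B} → (∀ v → A v ≡ B v) → ∀ i v → active r A i v ≡ active r B i v
  active-cong A≗B zero    v = A≗B v
  active-cong A≗B (suc i) v = step-cong (active-cong A≗B i) v

  active-step : ∀ A i v → active r (step r A) i v ≡ active r A (suc i) v
  active-step A zero    v = refl
  active-step A (suc i) v = step-cong (active-step A i) v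

  active-stable : ∀ {A} → (∀ v → step r A v ≡ A v) → ∀ i v → active r A i v ≡ A v
  active-stable stable zero    v = refl
  active-stable stable (suc i) v = trans (step-cong (active-stable stable i) v) (stable v)

  percolating-cong : ∀ {A B} → (∀ v → A v ≡ B v) → Percolating r A → Percolating r B
  percolating-cong A≗B percolates v with i , eq ← percolates v = i , trans (sym (active-cong A≗B i v)) eq

  percolating-step⁺ : ∀ A → Percolating r A → Percolating r (step r A)
  percolating-step⁺ A percolates v with i , eq ← percolates v =
    i , trans (active-step A i v) (step-extensive verts adj r (active r A i) v eq)

  percolating-step⁻ : ∀ A → Percolating r (step r A) → Percolating r A
  percolating-step⁻ A percolates v with i , eq ← percolates v = suc i , trans (sym (active-step A i v)) eq

  -- Each round that changes something activates a further vertex, so a fixed point comes within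
  -- `length verts` rounds; a fixed point percolates exactly when it contains every vertex.
  percolating? : ∀ A → Dec (Percolating r A)
  percolating? A = search (suc (length verts)) A (s≤s (m≤m+n _ _))
    where
    search : ∀ fuel A → length verts < fuel + size A → Dec (Percolating r A)
    search zero       A bound = ⊥-elim (<⇒≱ bound (count≤length A verts))
    search (suc fuel) A bound with all? (λ v → step r A v Bool.≟ A v) verts
    ... | no unstable = map′ (percolating-step⁻ A) (percolating-step⁺ A)
        (search fuel (step r A) (≤-trans bound (≤-trans (≤-reflexive (sym (+-suc fuel (size A)))) (+-monoʳ-≤ fuel grows))))
      where
      grows : size A < size (step r A)
      grows = count-mono-< (step-extensive verts adj r A) (All.¬All⇒Any¬ (λ v → step r A v Bool.≟ A v) verts unstable)
    ... | yes stable = map′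
      (λ all v → 0 , All.lookup all (complete v))
      (λ percolates → All.tabulate (λ {v} _ →
        let i , activeᵢ = percolates v
        in trans (sym (active-stable (λ u → All.lookup stable (complete u)) i v)) activeᵢ))
      (all? (λ v → A v Bool.≟ true) verts)

  minimum : ∀ A₀ → Percolating r A₀ → ∃[ A ] (Percolating r A × (∀ B → Percolating r B → size A ≤ size B))
  minimum A₀ percolates =
    -- The default `A₀` percolates, so the minimiser does so whether it is the default or a
    -- candidate.
    argmin size A₀ candidates ,
    argmin-all size percolates (All.all-filter percolating? (predicates _≟_ verts)) ,
    least
    where
    candidates = filter percolating? (predicates _≟_ verts)
    least : ∀ B → Percolating r B → size (argmin size A₀ candidates) ≤ size B
    least B Bpercolates with C , C∈ , C≗B ← predicates-complete _≟_ B verts =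
      ≤-trans (All.lookup (f[argmin]≤f[xs] A₀ candidates)
                (∈-filter⁺ percolating? C∈ (percolating-cong (λ v → sym (C≗B (complete v))) Bpercolates)))
              (≤-reflexive (count-cong (λ v → C≗B (complete v)) verts))

-- Arithmetic of the upper bound

-- The shape in which 2 d! (d − 1)² m ≤ ((d − 1)² − (d − 2)²) p needs no subtraction, with d = e + 2 and f = d!;
-- it rests on 2 (d − 1)² ≤ d (2 d − 3).
scaled-bound : ∀ e f m p → f * ((2 + e) * m) ≤ p →
  2 * f * ((1 + e) * (1 + e)) * m + e ℕ.^ 2 * p ≤ (1 + e) ℕ.^ 2 * p
scaled-bound e f m p h = begin
  2 * f * ((1 + e) * (1 + e)) * m + e ℕ.^ 2 * p                  ≤⟨ +-monoˡ-≤ (e ℕ.^ 2 * p) (m≤m+n _ (e * (f * m))) ⟩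
  (2 * f * ((1 + e) * (1 + e)) * m + e * (f * m)) + e ℕ.^ 2 * p  ≡⟨ cong (_+ e ℕ.^ 2 * p) (factor e f m) ⟩
  (1 + 2 * e) * (f * ((2 + e) * m)) + e ℕ.^ 2 * p                ≤⟨ +-monoˡ-≤ (e ℕ.^ 2 * p) (*-monoʳ-≤ (1 + 2 * e) h) ⟩
  (1 + 2 * e) * p + e ℕ.^ 2 * p                                  ≡⟨ squares e p ⟩
  (1 + e) ℕ.^ 2 * p                                              ∎
  where
  open ≤-Reasoning
  factor : ∀ e f m → 2 * f * ((1 + e) * (1 + e)) * m + e * (f * m) ≡ (1 + 2 * e) * (f * ((2 + e) * m))
  factor = solve-∀ⁿ
  squares : ∀ e p → (1 + 2 * e) * p + e * (e * 1) * p ≡ (1 + e) * ((1 + e) * 1) * p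
  squares = solve-∀ⁿ

pos-^ : ∀ a k → (+ a) ^ k ≡ + (a ℕ.^ k)
pos-^ a zero    = refl
pos-^ a (suc k) = trans (cong (+ a *ℤ_) (pos-^ a k)) (sym (ℤ.pos-* a (a ℕ.^ k)))

abs-^ : ∀ i k → ∣ i ^ k ∣ ≡ ∣ i ∣ ℕ.^ k
abs-^ i zero    = refl
abs-^ i (suc k) = trans (ℤ.abs-* i (i ^ k)) (cong (∣ i ∣ *_) (abs-^ i k))

i≤+∣i∣ : ∀ i → i ≤ℤ + ∣ i ∣
i≤+∣i∣ (+ n)    = ℤ.≤-refl
i≤+∣i∣ -[1+ n ] = -≤+

-- The base r - 2 is negative when r = 1, so its power is bounded through the absolute value.
i^k≤+a^k : ∀ i {a} k → ∣ i ∣ ≤ a → i ^ k ≤ℤ + (a ℕ.^ k)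
i^k≤+a^k i {a} k ∣i∣≤a = ℤ.≤-trans (i≤+∣i∣ (i ^ k))
  (ℤ.+≤+ (subst (_≤ a ℕ.^ k) (sym (abs-^ i k)) (^-monoˡ-≤ k ∣i∣≤a)))

+-≤⇒≤-difference : ∀ {l x y} {i : ℤ} → l + y ≤ x → i ≤ℤ + y → + l ≤ℤ + x - i
+-≤⇒≤-difference {l} {x} {y} {i} l+y≤x i≤y = begin
  + l                    ≡⟨ cancel (+ l) (+ y) ⟨
  (+ l +ℤ + y) - + y     ≡⟨ cong (_- + y) (ℤ.pos-+ l y) ⟨
  + (l + y) - + y        ≤⟨ ℤ.+-mono-≤ (ℤ.+≤+ l+y≤x) (ℤ.neg-mono-≤ i≤y) ⟩
  + x - i                ∎
  where
  open ℤ.≤-Reasoning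
  cancel : ∀ l y → (l +ℤ y) - y ≡ l
  cancel = solve-∀

-- Here r = s + 1, d = e + 2 and a = r + 2d - 1. The seed bound has base a - 1, and |r - 2| ≤ a, so
-- both powers may be replaced by a^d before `scaled-bound` is applied.
integer-upper-bound : ∀ e s m → let d = 2 + e in d ! * (d * m) ≤ (suc e + s + d) ℕ.^ d →
  + (2 * (d !) * (suc e * suc e) * m) ≤ℤ (+ suc e) ^ 2 *ℤ (+ (s + 2 * d)) ^ d - (+ e) ^ 2 *ℤ (+ suc s - + 2) ^ d
integer-upper-bound e s m bound =
  subst (λ x → + (2 * (d !) * (suc e * suc e) * m) ≤ℤ x - (+ e) ^ 2 *ℤ (+ suc s - + 2) ^ d) (sym (pos-square (suc e)))
    (+-≤⇒≤-difference (scaled-bound e (d !) m (a ℕ.^ d) (≤-trans bound (^-monoˡ-≤ d base≤a))) subtrahend)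
  where
  d = 2 + e
  a = s + 2 * d
  base≤a : suc e + s + d ≤ a
  base≤a = ≤-trans (n≤1+n _) (≤-reflexive (lemma e s))
    where
    lemma : ∀ e s → suc (suc e + s + (2 + e)) ≡ s + 2 * (2 + e)
    lemma = solve-∀ⁿ
  pos-square : ∀ c → (+ c) ^ 2 *ℤ (+ a) ^ d ≡ + (c ℕ.^ 2 * a ℕ.^ d)
  pos-square c = trans (cong₂ _*ℤ_ (pos-^ c 2) (pos-^ a d)) (sym (ℤ.pos-* (c ℕ.^ 2) (a ℕ.^ d)))
  ∣s-1∣≤a : ∣ + suc s - + 2 ∣ ≤ a
  ∣s-1∣≤a = ≤-trans (ℤ.∣i-j∣≤∣i∣+∣j∣ (+ suc s) (+ 2)) (≤-trans (m≤m+n _ (suc (2 * e))) (≤-reflexive (lemma e s)))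
    where
    lemma : ∀ e s → suc s + 2 + suc (2 * e) ≡ s + 2 * (2 + e)
    lemma = solve-∀ⁿ
  subtrahend : (+ e) ^ 2 *ℤ (+ suc s - + 2) ^ d ≤ℤ + (e ℕ.^ 2 * a ℕ.^ d)
  subtrahend = begin
    (+ e) ^ 2 *ℤ (+ suc s - + 2) ^ d       ≡⟨ cong (_*ℤ (+ suc s - + 2) ^ d) (pos-^ e 2) ⟩
    + (e ℕ.^ 2) *ℤ (+ suc s - + 2) ^ d     ≤⟨ ℤ.*-monoˡ-≤-nonNeg (+ (e ℕ.^ 2)) (i^k≤+a^k (+ suc s - + 2) d ∣s-1∣≤a) ⟩
    + (e ℕ.^ 2) *ℤ + (a ℕ.^ d)             ≡⟨ ℤ.pos-* (e ℕ.^ 2) (a ℕ.^ d) ⟨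
    + (e ℕ.^ 2 * a ℕ.^ d)                  ∎
    where open ℤ.≤-Reasoning

theorem4p4 : (n r d : ℕ) → 1 ≤ r → 2 ≤ d → r + 1 ≤ n →
    ∃[ m ] (IsMHamming n d r m
    × ((d + r) C (d + 1) ≤ r * m)
    × (+ (2 * (d !) * ((d ∸ 1) * (d ∸ 1)) * m)
    ≤ℤ ((+ (d ∸ 1)) ^ 2) *ℤ ((+ (r + 2 * d ∸ 1)) ^ d)
    - ((+ (d ∸ 2)) ^ 2) *ℤ ((+ r - + 2) ^ d)))
theorem4p4 n r@(suc s) d@(suc (suc e)) 1≤r (s≤s (s≤s _)) r+1≤n
  with r≤n ← m+n≤o⇒m≤o r r+1≤n
  with A , percolates , least ← Minimum.minimum (Vec.≡-dec Fin._≟_) (allVerts n d) ∈-allVerts hammingAdj r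
         (seed s) (seed-percolating s r≤n)
  -- The lower bound holds for the minimum set itself; the upper bound comes from comparing it with
  -- the seeds of sum at most s = r - 1.
  = size A , ((A , percolates , refl) , least) ,
    percolating-lower-bound r≤n A percolates ,
    integer-upper-bound e s (size A)
      (≤-trans (*-monoʳ-≤ (d !) (*-monoʳ-≤ d (least (seed s) (seed-percolating s r≤n)))) (seed-size n d s))
  where open Bootstrap (allVerts n d) hammingAdj
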